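{- Let $t$ be transcendental over $\mathbb{Q}$ and work over the field $\mathbb{Q}(t)$. There exist $a(t),b(t),c(t)\in\mathbb{Q}(t)$ such that the curve $E_t: y^2=a(t)x^4+b(t)x^2+c(t)$ is an elliptic curve over $\mathbb{Q}(t)$ and, for each $i\in\{\pm\tfrac12,\pm\tfrac32,\pm\tfrac52\}$, the curve $E_t$ has a $\mathbb{Q}(t)$-rational point with $x$-coordinate $(t+i)^2$. Consequently, there are infinitely many elliptic curves over $\mathbb{Q}$ of the form $y^2=ax^4+bx^2+c$ with $a,b,c\in\mathbb{Q}$ possessing a $6$-term sequence of consecutive squares.
   Context: Let $C$ be an elliptic curve over a field $K$ given by $y^2=P(x)$ with $P\in K[x]$ of degree $3$ or $4$. A sequence of points $(x_i,y_i)\in C(K)$, $i=1,2,\dots,n$, is a sequence of consecutive squares (of length $n$) if there is $u\in K$ with $x_i=(u+i)^2$ for $i=1,\dots,n$. The six values $(t+i)^2$, $i\in\{\pm\tfrac12,\pm\tfrac32,\pm\tfrac52\}$, are consecutive squares in this sense (take $u=t-\tfrac72$). -}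

module Defs where

open import Level using (_⊔_)
open import Algebra.Bundles using (CommutativeRing; RawRing)
open import Algebra.Apartness.Bundles using (HeytingField; HeytingCommutativeRing)
open import Algebra.Morphism.Structures using (module RingMorphisms)
import Algebra.Definitions.RawSemiring as RawSemiringOps
open import Data.Fin.Base using (Fin; toℕ)
open import Data.Integer.Base using (+_; -[1+_])
open import Data.List.Base using (List; []; _∷_; map)
open import Data.Nat.Base using (ℕ; zero; suc; _<_)
open import Data.Product.Base using (_×_; _,_; ∃; ∃₂)
open import Data.Rational.Base using (ℚ; _/_)
import Data.Rational.Properties as ℚ
open import Data.Sum.Base using (_⊎_)
open import Relation.Nullary.Negation using (¬_)

-- Fields are `HeytingField`s: `x # y` is the positive form of "x ≉ y"
-- (for ℚ it is `x ≢ y`), and `x # 0#` means that x is invertible.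

module OverField {k ℓ₁ ℓ₂} (K : HeytingField k ℓ₁ ℓ₂) where

  open HeytingField K public
    using (Carrier; _≈_; _#_; _+_; _*_; -_; _-_; 0#; 1#)

  ring : CommutativeRing k ℓ₁
  ring = HeytingCommutativeRing.commutativeRing
           (HeytingField.heytingCommutativeRing K)

  rawRing : RawRing k ℓ₁
  rawRing = CommutativeRing.rawRing ring

  open RawSemiringOps (RawRing.rawSemiring rawRing) public
    using (_^_)
    renaming (_×_ to _·_)

  -- Coefficient lists, constant term first.  Trailing zeros are allowed,
  -- so equality of polynomials is _≈ₚ_.

  Poly : Set k
  Poly = List Carrier

  coeff : Poly → ℕ → Carrier
  coeff []      _       = 0#
  coeff (a ∷ p) zero    = a
  coeff (a ∷ p) (suc n) = coeff p n

  infix 4 _≈ₚ_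
  _≈ₚ_ : Poly → Poly → Set ℓ₁
  p ≈ₚ q = ∀ n → coeff p n ≈ coeff q n

  eval : Poly → Carrier → Carrier
  eval []      x = 0#
  eval (a ∷ p) x = a + x * eval p x

  infixl 6 _+ₚ_
  _+ₚ_ : Poly → Poly → Poly
  []      +ₚ q       = q
  (a ∷ p) +ₚ []      = a ∷ p
  (a ∷ p) +ₚ (b ∷ q) = (a + b) ∷ (p +ₚ q)

  infixl 7 _*ₚ_
  _*ₚ_ : Poly → Poly → Poly
  []      *ₚ q = []
  (a ∷ p) *ₚ q = map (a *_) q +ₚ (0# ∷ p *ₚ q)

  derivative : Poly → Poly
  derivative []      = []
  derivative (_ ∷ p) = go 1 p
    where
    go : ℕ → Poly → Poly
    go n []      = []
    go n (a ∷ p) = (n · a) ∷ go (suc n) p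

  HasDegree : Poly → ℕ → Set (ℓ₁ ⊔ ℓ₂)
  HasDegree p n = coeff p n # 0# × (∀ m → n < m → coeff p m ≈ 0#)

  -- p has no repeated root in any extension field: p and p′ generate
  -- the unit ideal of K[x].
  Separable : Poly → Set (k ⊔ ℓ₁)
  Separable p = ∃₂ λ u v → u *ₚ p +ₚ v *ₚ derivative p ≈ₚ 1# ∷ []

  -- A polynomial P of degree 3 or 4 stands for the curve y² = P(x).

  OnCurve : Poly → Carrier → Carrier → Set ℓ₁
  OnCurve P x y = y ^ 2 ≈ eval P x

  -- A K-point of the smooth projective model w² = z⁴ P(x / z) in the
  -- weighted plane P(1,2,1).  The points at infinity are (1 : r : 0) with
  -- r² the coefficient of x⁴, so for a cubic there is exactly one (r = 0).
  HasRationalPoint : Poly → Set (k ⊔ ℓ₁)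
  HasRationalPoint P =
    (∃₂ λ x y → OnCurve P x y) ⊎ (∃ λ r → r ^ 2 ≈ coeff P 4)

  -- The curve y² = P(x) is smooth of genus one with a rational point
  -- (char K ≠ 2).
  IsEllipticCurve : Poly → Set (k ⊔ ℓ₁ ⊔ ℓ₂)
  IsEllipticCurve P =
    (HasDegree P 3 ⊎ HasDegree P 4) × Separable P × HasRationalPoint P

  biquadratic : Carrier → Carrier → Carrier → Poly
  biquadratic a b c = c ∷ 0# ∷ b ∷ 0# ∷ a ∷ []

  -- The points (xᵢ , yᵢ), 1 ≤ i ≤ n, are indexed from 0 by Fin n, whence
  -- the `suc`.
  HasConsecutiveSquares : Poly → ℕ → Set (k ⊔ ℓ₁)
  HasConsecutiveSquares P n =
    ∃ λ u → (i : Fin n) → ∃ λ y → OnCurve P ((u + suc (toℕ i) · 1#) ^ 2) y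

  -- For char K ≠ 2, 3, a smooth genus-one curve
  --   y² = a x⁴ + b x³ + c x² + d x + e   (a = 0 allowed)
  -- with a K-point is K-isomorphic to its Jacobian
  --   Y² = X³ - 27 I X - 27 J,
  -- where I and J are the classical invariants of the binary quartic.

  invariantI : Poly → Carrier
  invariantI P = 12 · (a * e) - 3 · (b * d) + c ^ 2
    where
    a = coeff P 4
    b = coeff P 3
    c = coeff P 2
    d = coeff P 1
    e = coeff P 0

  invariantJ : Poly → Carrier
  invariantJ P =
    72 · (a * c * e) + 9 · (b * c * d)
      - 27 · (a * d ^ 2) - 27 · (b ^ 2 * e) - 2 · (c ^ 3)
    where
    a = coeff P 4
    b = coeff P 3
    c = coeff P 2
    d = coeff P 1
    e = coeff P 0

  weierstrassA weierstrassB : Poly → Carrier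
  weierstrassA P = - (27 · invariantI P)
  weierstrassB P = - (27 · invariantJ P)

  -- Isomorphism over K of the elliptic curves y² = P(x) and y² = Q(x): a
  -- change of variables (X , Y) ↦ (s² X , s³ Y) between their Weierstrass
  -- equations Y² = X³ + A X + B.
  Isomorphic : Poly → Poly → Set (k ⊔ ℓ₁ ⊔ ℓ₂)
  Isomorphic P Q = ∃ λ s → s # 0#
    × weierstrassA Q ≈ s ^ 4 * weierstrassA P
    × weierstrassB Q ≈ s ^ 6 * weierstrassB P

module Overℚ = OverField ℚ.heytingField

-- K is the field ℚ(t), with t transcendental over ℚ.
record IsRationalFunctionField
         {k ℓ₁ ℓ₂} (K : HeytingField k ℓ₁ ℓ₂) (t : HeytingField.Carrier K)
         : Set (k ⊔ ℓ₁ ⊔ ℓ₂) where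
  open OverField K
  open RingMorphisms Overℚ.rawRing rawRing using (IsRingHomomorphism)
  field
    ι                  : ℚ → Carrier
    isRingHomomorphism : IsRingHomomorphism ι

  evalAt-t : Overℚ.Poly → Carrier
  evalAt-t p = eval (map ι p) t

  field
    transcendental : ∀ p → ¬ (p Overℚ.≈ₚ []) → evalAt-t p # 0#
    generated      : ∀ z → ∃₂ λ p q →
                       evalAt-t q # 0# × z * evalAt-t q ≈ evalAt-t p

-- ±1/2, ±3/2, ±5/2
offsets : List ℚ
offsets = -[1+ 4 ] / 2 ∷ -[1+ 2 ] / 2 ∷ -[1+ 0 ] / 2
        ∷ + 1 / 2 ∷ + 3 / 2 ∷ + 5 / 2 ∷ []

-- Put X_k = (t + k/2)⁴ for k = ±1, ±3, ±5 and complete the square: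
-- ∏ (X − X_k) = Q² − R with deg Q = 3 and deg R ≤ 2.  Then R(X_k) = Q(X_k)²,
-- so y² = R(x²) has points with x = (t + k/2)².
--
-- For the second claim, t is specialised to 11⁻¹, 11⁻², …  Writing ρ = t⁻¹, the
-- j-invariant of the curve is, up to a constant, N(ρ) / (ρ⁴ M(ρ)) with integer
-- polynomials N and M whose constant terms are prime to 11, so the 11-adic
-- valuations of the j-invariants are pairwise distinct.

module Submission where

open import Defs
open import Algebra.Apartness.Bundles using (HeytingField)
open import Algebra.Bundles using (CommutativeRing)
open import Algebra.Morphism.Construct.Identity using (isRingHomomorphism)
open import Algebra.Morphism.Structures using (module RingMorphisms)
import Algebra.Apartness.Properties.HeytingCommutativeRing as HeytingProperties
import Algebra.Properties.Semiring.Exp as Exp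
import Algebra.Solver.Ring as RingSolver
open import Algebra.Solver.Ring.AlmostCommutativeRing
  using (fromCommutativeRing; _-Raw-AlmostCommutative⟶_)
open import Data.Fin.Base using (zero; suc; toℕ)
open import Data.Fin.Properties using (all?)
open import Data.Integer.Base as ℤ using (ℤ; +_; -[1+_])
open import Data.Integer.Divisibility.Signed as Signed using (_∣_; divides)
import Data.Integer.Properties as ℤ
open import Data.Integer.Solver using (module +-*-Solver)
open import Data.List.Base using (List; []; _∷_; map; length; intersperse; lookup; _ʳ++_)
open import Data.List.Membership.Propositional.Properties using (∈-lookup)
open import Data.List.Properties using (≡-dec)
open import Data.List.Relation.Unary.All as All using (All; []; _∷_)
open import Data.Maybe.Base using (Maybe; just; nothing)
open import Data.Nat.Base as ℕ using (ℕ; zero; suc; s≤s)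
open import Data.Nat.Primality using (prime?; euclidsLemma)
import Data.Nat.Divisibility as ℕ∣
import Data.Nat.Properties as ℕ
open import Data.Product.Base using (_×_; _,_; ∃; ∃-syntax; proj₁; proj₂)
open import Data.Rational.Base as ℚ using (ℚ; 0ℚ; 1ℚ; ↥_; _/_)
open import Data.Rational.Literals using (fromℤ)
import Data.Rational.Properties as ℚ
open import Data.Sum.Base using (inj₁; inj₂; [_,_]′)
open import Data.Vec.Base using ([]; _∷_)
open import Function.Base using (_∘_; id)
open import Relation.Binary.Definitions using (tri<; tri≈; tri>)
open import Relation.Binary.PropositionalEquality
  using (_≡_; _≢_; refl; sym; trans; cong; cong₂; subst; module ≡-Reasoning)
import Relation.Binary.Reasoning.Setoid as SetoidReasoning
open import Relation.Nullary.Decidable using (yes; no; from-yes; from-no)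
open import Relation.Nullary.Negation using (¬_; contradiction)

-- The embedding of ℤ in ℚ.

fromℤ-+ : ∀ i j → fromℤ (i ℤ.+ j) ≡ fromℤ i ℚ.+ fromℤ j
fromℤ-+ i j = trans (sym (ℚ.↥p/↧p≡p (fromℤ (i ℤ.+ j))))
  (cong (_/ 1) (sym (cong₂ ℤ._+_ (ℤ.*-identityʳ i) (ℤ.*-identityʳ j))))

fromℤ-* : ∀ i j → fromℤ (i ℤ.* j) ≡ fromℤ i ℚ.* fromℤ j
fromℤ-* i j = sym (ℚ.↥p/↧p≡p (fromℤ (i ℤ.* j)))

fromℤ-neg : ∀ i → fromℤ (ℤ.- i) ≡ ℚ.- fromℤ i
fromℤ-neg (+ zero)    = refl
fromℤ-neg (+ (suc n)) = refl
fromℤ-neg -[1+ n ]    = refl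

-- Integer polynomials, constant term first, and the coefficients of the curve.

infixl 6 _⊞_
_⊞_ : List ℤ → List ℤ → List ℤ
[]      ⊞ q       = q
(a ∷ p) ⊞ []      = a ∷ p
(a ∷ p) ⊞ (b ∷ q) = (a ℤ.+ b) ∷ (p ⊞ q)

infixl 7 _⊠_
_⊠_ : List ℤ → List ℤ → List ℤ
[]      ⊠ q = []
(a ∷ p) ⊠ q = map (a ℤ.*_) q ⊞ (+ 0 ∷ p ⊠ q)

square : List ℤ → List ℤ
square p = p ⊠ p

infix 4 _≟_
_≟_ = ≡-dec ℤ._≟_

-- With R = α X² + β X + γ, the coefficients of (128 / 3t¹⁰)² R are
--   (2ρ)⁸ A(ρ) , (2ρ)⁴ B(ρ) , C(ρ)   where ρ = t⁻¹,
-- and D is (B² − 4AC) / ρ².  Opacity keeps the conversion checker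
-- from evaluating these polynomials at powers of 11.
opaque
  A B C D : List ℤ
  A = intersperse (+ 0) (+ 5376 ∷ + 779520 ∷ + 11657184 ∷ + 57509200 ∷ + 95561365 ∷ + 36613360 ∷ [])
  B = intersperse (+ 0) (ℤ.- + 172032 ∷ ℤ.- + 12226560 ∷ ℤ.- + 142317056 ∷ ℤ.- + 290106880
        ∷ + 3535789728 ∷ + 17515149680 ∷ + 15359978326 ∷ ℤ.- + 2882657760 ∷ [])
  C = intersperse (+ 0) (+ 1376256 ∷ + 22282240 ∷ ℤ.- + 179257344 ∷ + 18522685440 ∷ + 386329853440
        ∷ + 2891893079040 ∷ + 9725234221248 ∷ + 14183872098880 ∷ + 7346950485525 ∷ + 2863350000 ∷ [])
  D = intersperse (+ 0) (ℤ.- + 563714457600 ∷ + 68658810322944 ∷ + 2384956080783360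
        ∷ ℤ.- + 37224486788923392 ∷ ℤ.- + 2107880233091727360 ∷ ℤ.- + 32791829684517076992
        ∷ ℤ.- + 268809960523376885760 ∷ ℤ.- + 1315449394830396358656
        ∷ ℤ.- + 3967670359686129008640 ∷ ℤ.- + 7329282476845633511424
        ∷ ℤ.- + 8018537519836288005120 ∷ ℤ.- + 4751325435319040385024
        ∷ ℤ.- + 1165635796082448875520 ∷ + 7890368303864217600 ∷ [])

constantTerm : List ℤ → ℤ
constantTerm []      = + 0
constantTerm (a ∷ p) = a

-- The j-invariant is a constant multiple of jNumerator(ρ) / (ρ⁴ jDenominator(ρ)).
I jNumerator jDenominator : List ℤ
I = (+ 12 ∷ []) ⊠ (A ⊠ C) ⊞ square B
jNumerator = I ⊠ square I
jDenominator = A ⊠ C ⊠ square D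

-- (2ρ)⁴ X_k = (2 + kρ)⁴, so curveAt k is (128 / 3t¹⁰)² R(X_k) as a polynomial in ρ.
quartic : ℤ → List ℤ
quartic k = square (square (+ 2 ∷ k ∷ []))

curveAt : ℤ → List ℤ
curveAt k = A ⊠ square (quartic k) ⊞ B ⊠ quartic k ⊞ C

-- ρ y_k(ρ) = ± (128 / 3t¹⁰) Q(X_k).
y₋₅ y₋₃ y₋₁ y₁ y₃ y₅ : List ℤ
y₋₅ = + 12800 ∷ ℤ.- + 119808 ∷ + 680320 ∷ ℤ.- + 1711360 ∷ + 5468000
    ∷ ℤ.- + 6883008 ∷ + 11290760 ∷ ℤ.- + 6063920 ∷ + 3536000 ∷ []
y₋₃ = + 8704 ∷ ℤ.- + 82944 ∷ + 232832 ∷ ℤ.- + 1102080 ∷ + 1091680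
    ∷ ℤ.- + 4185024 ∷ + 1420232 ∷ ℤ.- + 3362544 ∷ + 97920 ∷ []
y₋₁ = + 5632 ∷ ℤ.- + 36864 ∷ + 24704 ∷ ℤ.- + 609280 ∷ + 124960
    ∷ ℤ.- + 2697984 ∷ + 13144 ∷ ℤ.- + 2701376 ∷ ℤ.- + 4160 ∷ []
y₁  = + 5632 ∷ + 36864 ∷ + 24704 ∷ + 609280 ∷ + 124960
    ∷ + 2697984 ∷ + 13144 ∷ + 2701376 ∷ ℤ.- + 4160 ∷ []
y₃  = + 8704 ∷ + 82944 ∷ + 232832 ∷ + 1102080 ∷ + 1091680
    ∷ + 4185024 ∷ + 1420232 ∷ + 3362544 ∷ + 97920 ∷ []
y₅  = + 12800 ∷ + 119808 ∷ + 680320 ∷ + 1711360 ∷ + 5468000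
    ∷ + 6883008 ∷ + 11290760 ∷ + 6063920 ∷ + 3536000 ∷ []

-- Polynomial identities and residues modulo 11, decided by computation.

opaque
  unfolding A B C D

  B²≡4AC+x²D : square B ≡ (+ 4 ∷ []) ⊠ (A ⊠ C) ⊞ (+ 0 ∷ + 0 ∷ D)
  B²≡4AC+x²D = from-yes (square B ≟ (+ 4 ∷ []) ⊠ (A ⊠ C) ⊞ (+ 0 ∷ + 0 ∷ D))

  y₋₅²≡curveAt : square (+ 0 ∷ y₋₅) ≡ curveAt -[1+ 4 ]
  y₋₅²≡curveAt = from-yes (square (+ 0 ∷ y₋₅) ≟ curveAt -[1+ 4 ])

  y₋₃²≡curveAt : square (+ 0 ∷ y₋₃) ≡ curveAt -[1+ 2 ]
  y₋₃²≡curveAt = from-yes (square (+ 0 ∷ y₋₃) ≟ curveAt -[1+ 2 ])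

  y₋₁²≡curveAt : square (+ 0 ∷ y₋₁) ≡ curveAt -[1+ 0 ]
  y₋₁²≡curveAt = from-yes (square (+ 0 ∷ y₋₁) ≟ curveAt -[1+ 0 ])

  y₁²≡curveAt : square (+ 0 ∷ y₁) ≡ curveAt (+ 1)
  y₁²≡curveAt = from-yes (square (+ 0 ∷ y₁) ≟ curveAt (+ 1))

  y₃²≡curveAt : square (+ 0 ∷ y₃) ≡ curveAt (+ 3)
  y₃²≡curveAt = from-yes (square (+ 0 ∷ y₃) ≟ curveAt (+ 3))

  y₅²≡curveAt : square (+ 0 ∷ y₅) ≡ curveAt (+ 5)
  y₅²≡curveAt = from-yes (square (+ 0 ∷ y₅) ≟ curveAt (+ 5))

  -- For `A`, `C` and `D` this yields nonzero values both at t⁻¹, where a nonzero constant term is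
  -- enough, and at positive powers of 11. For `jNumerator` and `jDenominator` it makes the values
  -- at positive powers of 11 prime to 11.
  11∤A : ¬ + 11 ∣ constantTerm A
  11∤A = from-no (+ 11 Signed.∣? constantTerm A)

  11∤C : ¬ + 11 ∣ constantTerm C
  11∤C = from-no (+ 11 Signed.∣? constantTerm C)

  11∤D : ¬ + 11 ∣ constantTerm D
  11∤D = from-no (+ 11 Signed.∣? constantTerm D)

  11∤jNumerator : ¬ + 11 ∣ constantTerm jNumerator
  11∤jNumerator = from-no (+ 11 Signed.∣? constantTerm jNumerator)

  11∤jDenominator : ¬ + 11 ∣ constantTerm jDenominator
  11∤jDenominator = from-no (+ 11 Signed.∣? constantTerm jDenominator)

-- Integer polynomials evaluated in an extension field of ℚ.

module Extension {k ℓ₁ ℓ₂} (L : HeytingField k ℓ₁ ℓ₂)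
  (ι : ℚ → HeytingField.Carrier L)
  (ι-isRingHomomorphism :
    RingMorphisms.IsRingHomomorphism Overℚ.rawRing (OverField.rawRing L) ι)
  where

  open OverField L
  open CommutativeRing ring using
    ( setoid; +-cong; +-congˡ; +-congʳ; *-cong; *-congˡ; *-congʳ; +-identityˡ; +-identityʳ
    ; zeroˡ; zeroʳ; *-identityˡ; *-identityʳ; -‿cong)
    renaming (refl to ≈-refl; sym to ≈-sym; trans to ≈-trans; reflexive to ≈-reflexive)
  open HeytingField L using (heytingCommutativeRing; #⇒invertible)
  open HeytingProperties heytingCommutativeRing
  open Exp (CommutativeRing.semiring ring) using (^-congˡ)
  open SetoidReasoning setoid
  module ι = RingMorphisms.IsRingHomomorphism ι-isRingHomomorphism

  φ : ℤ → Carrier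
  φ = ι ∘ fromℤ

  φ-+ : ∀ i j → φ (i ℤ.+ j) ≈ φ i + φ j
  φ-+ i j = ≈-trans (ι.⟦⟧-cong (fromℤ-+ i j)) (ι.+-homo _ _)

  φ-* : ∀ i j → φ (i ℤ.* j) ≈ φ i * φ j
  φ-* i j = ≈-trans (ι.⟦⟧-cong (fromℤ-* i j)) (ι.*-homo _ _)

  φ-neg : ∀ i → φ (ℤ.- i) ≈ - φ i
  φ-neg i = ≈-trans (ι.⟦⟧-cong (fromℤ-neg i)) (ι.-‿homo _)

  -- Sending 0 and 1 to 0# and 1# on the nose lets the ring solver
  -- recognise the literals that come out of evaluating list operations.
  ψ : ℤ → Carrier
  ψ (+ 0) = 0#
  ψ (+ 1) = 1#
  ψ i     = φ i

  ψ≈φ : ∀ i → ψ i ≈ φ i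
  ψ≈φ (+ 0)           = ≈-sym ι.0#-homo
  ψ≈φ (+ 1)           = ≈-sym ι.1#-homo
  ψ≈φ (+ suc (suc n)) = ≈-refl
  ψ≈φ -[1+ n ]        = ≈-refl

  ψ-morphism : ℤ.+-*-rawRing -Raw-AlmostCommutative⟶ fromCommutativeRing ring
  ψ-morphism = record
    { ⟦_⟧    = ψ
    ; +-homo = λ i j → ≈-trans (ψ≈φ _)
        (≈-trans (φ-+ i j) (≈-sym (+-cong (ψ≈φ i) (ψ≈φ j))))
    ; *-homo = λ i j → ≈-trans (ψ≈φ _)
        (≈-trans (φ-* i j) (≈-sym (*-cong (ψ≈φ i) (ψ≈φ j))))
    ; -‿homo = λ i → ≈-trans (ψ≈φ _) (≈-trans (φ-neg i) (≈-sym (-‿cong (ψ≈φ i))))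
    ; 0-homo = ≈-refl
    ; 1-homo = ≈-refl
    }

  ψ-≟ : ∀ i j → Maybe (ψ i ≈ ψ j)
  ψ-≟ i j with i ℤ.≟ j
  ... | yes i≡j = just (≈-reflexive (cong ψ i≡j))
  ... | no  _   = nothing

  open RingSolver ℤ.+-*-rawRing (fromCommutativeRing ring) ψ-morphism ψ-≟ public
    using (Polynomial; con; _:=_; _:+_; _:*_; _:-_; :-_; _:^_; _:×_; solve; prove; var)
    renaming (⟦_⟧ to semantics)

  -- The inverse is the image of the inverse in ℚ: an extension of ℚ has characteristic 0.
  φ-# : ∀ i → i ≢ + 0 → φ i # 0#
  φ-# i i≢0 = invertibleˡ⇒#
    (ι (ℚ.1/ q) , (begin
      ι (ℚ.1/ q) * (φ i - 0#)  ≈⟨ *-congˡ (x-0≈x _) ⟩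
      ι (ℚ.1/ q) * ι q         ≈⟨ ι.*-homo (ℚ.1/ q) q ⟨
      ι (ℚ.1/ q ℚ.* q)         ≈⟨ ι.⟦⟧-cong (ℚ.*-inverseˡ q) ⟩
      ι 1ℚ                     ≈⟨ ι.1#-homo ⟩
      1#                       ∎))
    where
    q = fromℤ i
    instance _ = ℚ.≢-nonZero {fromℤ i} (λ q≡0 → i≢0 (cong ↥_ q≡0))

  -- The two maps are kept apart so that `⟦ p ⟧ t` is, by definition, `evalAt-t (map fromℤ p)`;
  -- transcendence of t then applies directly.
  ⟦_⟧ : List ℤ → Carrier → Carrier
  ⟦ p ⟧ x = eval (map ι (map fromℤ p)) x

  ⟦⟧-⊞ : ∀ p q x → ⟦ p ⊞ q ⟧ x ≈ ⟦ p ⟧ x + ⟦ q ⟧ x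
  ⟦⟧-⊞ []      q       x = ≈-sym (+-identityˡ _)
  ⟦⟧-⊞ (a ∷ p) []      x = ≈-sym (+-identityʳ _)
  ⟦⟧-⊞ (a ∷ p) (b ∷ q) x = begin
    φ (a ℤ.+ b) + x * ⟦ p ⊞ q ⟧ x            ≈⟨ +-cong (φ-+ a b) (*-congˡ (⟦⟧-⊞ p q x)) ⟩
    φ a + φ b + x * (⟦ p ⟧ x + ⟦ q ⟧ x)      ≈⟨ solve 5 (λ a b x p q →
      a :+ b :+ x :* (p :+ q) := (a :+ x :* p) :+ (b :+ x :* q)) ≈-refl _ _ _ _ _ ⟩
    (φ a + x * ⟦ p ⟧ x) + (φ b + x * ⟦ q ⟧ x)  ∎

  ⟦⟧-map-* : ∀ a p x → ⟦ map (a ℤ.*_) p ⟧ x ≈ φ a * ⟦ p ⟧ x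
  ⟦⟧-map-* a []      x = ≈-sym (zeroʳ _)
  ⟦⟧-map-* a (b ∷ p) x = begin
    φ (a ℤ.* b) + x * ⟦ map (a ℤ.*_) p ⟧ x  ≈⟨ +-cong (φ-* a b) (*-congˡ (⟦⟧-map-* a p x)) ⟩
    φ a * φ b + x * (φ a * ⟦ p ⟧ x)         ≈⟨ solve 4 (λ a b x p →
      a :* b :+ x :* (a :* p) := a :* (b :+ x :* p)) ≈-refl _ _ _ _ ⟩
    φ a * (φ b + x * ⟦ p ⟧ x)               ∎

  ⟦⟧-⊠ : ∀ p q x → ⟦ p ⊠ q ⟧ x ≈ ⟦ p ⟧ x * ⟦ q ⟧ x
  ⟦⟧-⊠ []      q x = ≈-sym (zeroˡ _)
  ⟦⟧-⊠ (a ∷ p) q x = begin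
    ⟦ map (a ℤ.*_) q ⊞ (+ 0 ∷ p ⊠ q) ⟧ x         ≈⟨ ⟦⟧-⊞ (map (a ℤ.*_) q) _ x ⟩
    ⟦ map (a ℤ.*_) q ⟧ x + (φ (+ 0) + x * ⟦ p ⊠ q ⟧ x)
      ≈⟨ +-cong (⟦⟧-map-* a q x) (+-cong ι.0#-homo (*-congˡ (⟦⟧-⊠ p q x))) ⟩
    φ a * ⟦ q ⟧ x + (0# + x * (⟦ p ⟧ x * ⟦ q ⟧ x))  ≈⟨ solve 4 (λ a x p q →
      a :* q :+ (con (+ 0) :+ x :* (p :* q)) := (a :+ x :* p) :* q) ≈-refl _ _ _ _ ⟩
    (φ a + x * ⟦ p ⟧ x) * ⟦ q ⟧ x                ∎

  ⟦⟧-cong : ∀ {p q} x → p ≡ q → ⟦ p ⟧ x ≈ ⟦ q ⟧ x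
  ⟦⟧-cong x p≡q = ≈-reflexive (cong (λ p → ⟦ p ⟧ x) p≡q)

  -- Separability of biquadratic polynomials.

  -- The discriminant of the quadratic in z = x². The quartic itself has discriminant 16ac times its
  -- square.
  discriminant : Carrier → Carrier → Carrier → Carrier
  discriminant a b c = b * b - φ (+ 4) * (a * c)

  -- These mirror the operations of Defs on solver expressions, so that their
  -- interpretation computes to coefficients of actual polynomials.
  module Coefficients where

    infixl 6 _⊕_
    _⊕_ : ∀ {n} → List (Polynomial n) → List (Polynomial n) → List (Polynomial n)
    []      ⊕ q       = q
    (a ∷ p) ⊕ []      = a ∷ p
    (a ∷ p) ⊕ (b ∷ q) = (a :+ b) ∷ (p ⊕ q)

    infixl 7 _⊗_
    _⊗_ : ∀ {n} → List (Polynomial n) → List (Polynomial n) → List (Polynomial n)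
    []      ⊗ q = []
    (a ∷ p) ⊗ q = map (a :*_) q ⊕ (con (+ 0) ∷ p ⊗ q)

    coefficient : ∀ {n} → List (Polynomial n) → ℕ → Polynomial n
    coefficient []      _       = con (+ 0)
    coefficient (a ∷ p) zero    = a
    coefficient (a ∷ p) (suc n) = coefficient p n

  -- With z = x² and f = a z² + b z + c, so that P′ = 2x f′(z), eliminate z from
  --   2zΔ = x f′(z) P′ − 8az f   and   c = f − z (az + b)
  -- to write 2Δc as a combination of P and P′; w will be the inverse of 2Δc.
  module Bezout {n} (a b c w : Polynomial n) where

    open Coefficients

    P P′ U V : List (Polynomial n)
    Δ N : Polynomial n
    P  = c ∷ con (+ 0) ∷ b ∷ con (+ 0) ∷ a ∷ []
    P′ = 1 :× con (+ 0) ∷ 2 :× b ∷ 3 :× con (+ 0) ∷ 4 :× a ∷ []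
    Δ  = b :* b :- con (+ 4) :* (a :* c)
    N  = 2 :× (Δ :* c)
    U  = w :* 2 :× Δ ∷ con (+ 0) ∷ w :* 8 :× (a :* b) ∷ con (+ 0) ∷ w :* 8 :× (a :* a) ∷ []
    V  = con (+ 0) ∷ :- (w :* (b :* b)) ∷ con (+ 0) ∷ :- (w :* 3 :× (a :* b))
           ∷ con (+ 0) ∷ :- (w :* 2 :× (a :* a)) ∷ []

    combination : ℕ → Polynomial n
    combination = coefficient (U ⊗ P ⊕ V ⊗ P′)

  separable : ∀ {a b c} → c # 0# → discriminant a b c # 0# → Separable (biquadratic a b c)
  separable {a} {b} {c} c#0 Δ#0 = map ⟦_⟧ρ U , map ⟦_⟧ρ V , bezout
    where
    open Bezout (var zero) (var (suc zero)) (var (suc (suc zero))) (var (suc (suc (suc zero))))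
    Δ₁ = discriminant a b c
    N#0 : 2 · (Δ₁ * c) # 0#
    N#0 = #-congʳ (solve 1 (λ x → con (+ 2) :* x := 2 :× x) ≈-refl _)
      (x#0y#0→xy#0 (φ-# (+ 2) λ ()) (x#0y#0→xy#0 Δ#0 c#0))
    w = proj₁ (#⇒invertible N#0)
    ρ = a ∷ b ∷ c ∷ w ∷ []
    ⟦_⟧ρ : Polynomial 4 → Carrier
    ⟦ e ⟧ρ = semantics e ρ
    wN≈1 : w * 2 · (Δ₁ * c) ≈ 1#
    wN≈1 = ≈-trans (*-congˡ (≈-sym (x-0≈x _))) (proj₁ (proj₂ (#⇒invertible N#0)))
    bezout : map ⟦_⟧ρ U *ₚ biquadratic a b c +ₚ map ⟦_⟧ρ V *ₚ derivative (biquadratic a b c)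
               ≈ₚ 1# ∷ []
    -- Only the constant coefficient uses the choice of w. Those of index 1 to 8 vanish identically
    -- in a, b, c, w, and from index 9 on both lists are exhausted.
    bezout 0 = ≈-trans (prove ρ (combination 0) (var (suc (suc (suc zero))) :* N) ≈-refl) wN≈1
    bezout 1 = prove ρ (combination 1) (con (+ 0)) ≈-refl
    bezout 2 = prove ρ (combination 2) (con (+ 0)) ≈-refl
    bezout 3 = prove ρ (combination 3) (con (+ 0)) ≈-refl
    bezout 4 = prove ρ (combination 4) (con (+ 0)) ≈-refl
    bezout 5 = prove ρ (combination 5) (con (+ 0)) ≈-refl
    bezout 6 = prove ρ (combination 6) (con (+ 0)) ≈-refl
    bezout 7 = prove ρ (combination 7) (con (+ 0)) ≈-refl
    bezout 8 = prove ρ (combination 8) (con (+ 0)) ≈-refl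
    bezout (suc (suc (suc (suc (suc (suc (suc (suc (suc n))))))))) = ≈-refl

  -- The Jacobian and the j-invariant of a biquadratic.

  #-cancelˡ : ∀ {x y z} → x # 0# → x * y ≈ x * z → y ≈ z
  #-cancelˡ {x} {y} {z} x#0 xy≈xz = begin
    y             ≈⟨ unit y ⟨
    x⁻¹ * (x * y) ≈⟨ *-congˡ xy≈xz ⟩
    x⁻¹ * (x * z) ≈⟨ unit z ⟩
    z             ∎
    where
    x⁻¹ = proj₁ (#⇒invertible x#0)
    unit : ∀ u → x⁻¹ * (x * u) ≈ u
    unit u = begin
      x⁻¹ * (x * u)         ≈⟨ solve 3 (λ i x u → i :* (x :* u) := i :* (x :- con (+ 0)) :* u) ≈-refl _ _ _ ⟩
      x⁻¹ * (x - 0#) * u    ≈⟨ *-congʳ (proj₁ (proj₂ (#⇒invertible x#0))) ⟩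
      1# * u                ≈⟨ *-identityˡ u ⟩
      u                     ∎

  weierstrassA-biquadratic : ∀ a b c →
    weierstrassA (biquadratic a b c) ≈ φ -[1+ 26 ] * (φ (+ 12) * (a * c) + b * b)
  weierstrassA-biquadratic = solve 3 (λ a b c → let o = con (+ 0) in
    :- (27 :× (12 :× (a :* c) :- 3 :× (o :* o) :+ b :^ 2))
      := con -[1+ 26 ] :* (con (+ 12) :* (a :* c) :+ b :* b)) ≈-refl

  weierstrassB-biquadratic : ∀ a b c →
    weierstrassB (biquadratic a b c) ≈ φ -[1+ 26 ] * (φ (+ 72) * (a * b * c) - φ (+ 2) * b ^ 3)
  weierstrassB-biquadratic = solve 3 (λ a b c → let o = con (+ 0) in
    :- (27 :× (72 :× (a :* b :* c) :+ 9 :× (o :* b :* o)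
          :- 27 :× (a :* o :^ 2) :- 27 :× (o :^ 2 :* c) :- 2 :× (b :^ 3)))
      := con -[1+ 26 ] :* (con (+ 72) :* (a :* b :* c) :- con (+ 2) :* b :^ 3)) ≈-refl

  -- 4A³ + 27B² for the Jacobian Y² = X³ + AX + B is −27³ · 432 · ac(b² − 4ac)².
  jacobianDiscriminant : ∀ a b c →
    let P = biquadratic a b c; Δ = discriminant a b c in
    φ (+ 4) * weierstrassA P ^ 3 + φ (+ 27) * weierstrassB P ^ 2
      ≈ φ -[1+ 8503055 ] * (a * c * (Δ * Δ))
  jacobianDiscriminant a b c = ≈-trans
    (+-cong (*-congˡ (^-congˡ 3 (weierstrassA-biquadratic a b c)))
            (*-congˡ (^-congˡ 2 (weierstrassB-biquadratic a b c))))
    (solve 3 (λ a b c →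
      let Δ = b :* b :- con (+ 4) :* (a :* c) in
      con (+ 4) :* (con -[1+ 26 ] :* (con (+ 12) :* (a :* c) :+ b :* b)) :^ 3
        :+ con (+ 27) :* (con -[1+ 26 ] :* (con (+ 72) :* (a :* b :* c) :- con (+ 2) :* b :^ 3)) :^ 2
        := con -[1+ 8503055 ] :* (a :* c :* (Δ :* Δ))) ≈-refl a b c)

  -- The j-invariant is proportional to (12ac + b²)³ / (ac(b² − 4ac)²).
  j-invariance : ∀ {a b c a′ b′ c′} → Isomorphic (biquadratic a b c) (biquadratic a′ b′ c′) →
    let Δ = discriminant a b c; Δ′ = discriminant a′ b′ c′ in
    (φ (+ 12) * (a′ * c′) + b′ * b′) ^ 3 * (a * c * (Δ * Δ)) ≈
    (φ (+ 12) * (a * c) + b * b) ^ 3 * (a′ * c′ * (Δ′ * Δ′))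
  j-invariance {a} {b} {c} {a′} {b′} {c′} (s , _ , A′≈s⁴A , B′≈s⁶B) =
    #-cancelˡ (φ-# -[1+ 8503055 ] λ ()) (#-cancelˡ (φ-# -[1+ 19682 ] λ ()) (begin
      κ * (μ * (I′ ^ 3 * h))
        ≈⟨ rescale a′ b′ c′ h ⟨
      A′ ^ 3 * (μ * h)
        ≈⟨ *-cong (^-congˡ 3 A′≈s⁴A) (≈-sym (jacobianDiscriminant a b c)) ⟩
      (s ^ 4 * A₀) ^ 3 * (φ (+ 4) * A₀ ^ 3 + φ (+ 27) * B₀ ^ 2)
        -- A³ and 4A³ + 27B² both have weight 12, so s¹² passes from the first factor to the second.
        -- This compares j-invariants without division.
        ≈⟨ solve 5 (λ s A B x y → (s :^ 4 :* A) :^ 3 :* (x :* A :^ 3 :+ y :* B :^ 2) :=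
             A :^ 3 :* (x :* (s :^ 4 :* A) :^ 3 :+ y :* (s :^ 6 :* B) :^ 2)) ≈-refl s A₀ B₀ _ _ ⟩
      A₀ ^ 3 * (φ (+ 4) * (s ^ 4 * A₀) ^ 3 + φ (+ 27) * (s ^ 6 * B₀) ^ 2)
        ≈⟨ *-congˡ (+-cong (*-congˡ (^-congˡ 3 A′≈s⁴A)) (*-congˡ (^-congˡ 2 B′≈s⁶B))) ⟨
      A₀ ^ 3 * (φ (+ 4) * A′ ^ 3 + φ (+ 27) * B′ ^ 2)
        ≈⟨ *-congˡ (jacobianDiscriminant a′ b′ c′) ⟩
      A₀ ^ 3 * (μ * h′)
        ≈⟨ rescale a b c h′ ⟩
      κ * (μ * (I₀ ^ 3 * h′))  ∎))
    where
    Δ  = discriminant a b c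
    Δ′ = discriminant a′ b′ c′
    h  = a * c * (Δ * Δ)
    h′ = a′ * c′ * (Δ′ * Δ′)
    A₀ = weierstrassA (biquadratic a b c)
    B₀ = weierstrassB (biquadratic a b c)
    A′ = weierstrassA (biquadratic a′ b′ c′)
    B′ = weierstrassB (biquadratic a′ b′ c′)
    I₀ = φ (+ 12) * (a * c) + b * b
    I′ = φ (+ 12) * (a′ * c′) + b′ * b′
    -- (-27)³, from cubing A = -27(12ac + b²); `μ` is the constant of `jacobianDiscriminant`.
    κ = φ -[1+ 19682 ]
    μ = φ -[1+ 8503055 ]
    rescale : ∀ a b c h →
      weierstrassA (biquadratic a b c) ^ 3 * (μ * h) ≈
      κ * (μ * ((φ (+ 12) * (a * c) + b * b) ^ 3 * h))
    rescale a b c h = ≈-trans (*-congʳ (^-congˡ 3 (weierstrassA-biquadratic a b c)))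
      (solve 3 (λ i m h → (con -[1+ 26 ] :* i) :^ 3 :* (m :* h)
        := con -[1+ 19682 ] :* (m :* (i :^ 3 :* h))) ≈-refl _ _ _)

  ^-# : ∀ {x} n → x # 0# → x ^ n # 0#
  ^-# zero    x#0 = 1#0
  ^-# (suc n) x#0 = x#0y#0→xy#0 x#0 (^-# n x#0)

  -- The family of curves with parameter ρ.

  module Curve (ρ w : Carrier) (ρw≈1 : ρ * w ≈ 1#) where

    -- Here `w` plays the part of t and `ρ` that of t⁻¹. The same formulas thus serve over ℚ(t) and
    -- for rational values of t.
    g a b c : Carrier
    g = φ (+ 2) * ρ
    a = g ^ 8 * ⟦ A ⟧ ρ
    b = g ^ 4 * ⟦ B ⟧ ρ
    c = ⟦ C ⟧ ρ

    curve : Poly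
    curve = biquadratic a b c

    ρ#0 : ρ # 0#
    ρ#0 = invertibleʳ⇒# (w , ≈-trans (*-congʳ (x-0≈x ρ)) ρw≈1)

    g#0 : g # 0#
    g#0 = x#0y#0→xy#0 (φ-# (+ 2) λ ()) ρ#0

    B²-4AC : ⟦ B ⟧ ρ * ⟦ B ⟧ ρ - φ (+ 4) * (⟦ A ⟧ ρ * ⟦ C ⟧ ρ) ≈ ρ * (ρ * ⟦ D ⟧ ρ)
    B²-4AC = begin
      ⟦ B ⟧ ρ * ⟦ B ⟧ ρ - φ (+ 4) * (⟦ A ⟧ ρ * ⟦ C ⟧ ρ)
        ≈⟨ +-congʳ (≈-sym (⟦⟧-⊠ B B ρ)) ⟩
      ⟦ square B ⟧ ρ - φ (+ 4) * (⟦ A ⟧ ρ * ⟦ C ⟧ ρ)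
        ≈⟨ +-congʳ (⟦⟧-cong ρ B²≡4AC+x²D) ⟩
      ⟦ (+ 4 ∷ []) ⊠ (A ⊠ C) ⊞ (+ 0 ∷ + 0 ∷ D) ⟧ ρ - φ (+ 4) * (⟦ A ⟧ ρ * ⟦ C ⟧ ρ)
        ≈⟨ +-congʳ (≈-trans (⟦⟧-⊞ ((+ 4 ∷ []) ⊠ (A ⊠ C)) (+ 0 ∷ + 0 ∷ D) ρ)
             (+-cong (≈-trans (⟦⟧-⊠ (+ 4 ∷ []) (A ⊠ C) ρ) (*-congˡ (⟦⟧-⊠ A C ρ)))
               (+-cong ι.0#-homo (*-congˡ (+-congʳ ι.0#-homo))))) ⟩
      (φ (+ 4) + ρ * 0#) * (⟦ A ⟧ ρ * ⟦ C ⟧ ρ) + (0# + ρ * (0# + ρ * ⟦ D ⟧ ρ))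
        - φ (+ 4) * (⟦ A ⟧ ρ * ⟦ C ⟧ ρ)
        ≈⟨ solve 5 (λ A C D ρ f → let o = con (+ 0) in
             (f :+ ρ :* o) :* (A :* C) :+ (o :+ ρ :* (o :+ ρ :* D)) :- f :* (A :* C)
               := ρ :* (ρ :* D)) ≈-refl (⟦ A ⟧ ρ) (⟦ C ⟧ ρ) (⟦ D ⟧ ρ) ρ _ ⟩
      ρ * (ρ * ⟦ D ⟧ ρ)  ∎

    discriminant-curve : discriminant a b c ≈ g ^ 8 * (ρ * (ρ * ⟦ D ⟧ ρ))
    discriminant-curve = ≈-trans
      (solve 4 (λ g A B C → let f = con (+ 4) in
         (g :^ 4 :* B) :* (g :^ 4 :* B) :- f :* (g :^ 8 :* A :* C)
           := g :^ 8 :* (B :* B :- f :* (A :* C))) ≈-refl g (⟦ A ⟧ ρ) (⟦ B ⟧ ρ) (⟦ C ⟧ ρ))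
      (*-congˡ B²-4AC)

    -- Put u = w + q. As ρw = 1 and k = 2q, multiplying u by g = 2ρ gives 2 + kρ, whose fourth power
    -- is `quartic k`. So the polynomial of the curve at u² takes the value of `curveAt k` at ρ,
    -- which is a square.
    onCurve : ∀ q k Y → fromℤ (+ 2) ℚ.* q ≡ fromℤ k → square (+ 0 ∷ Y) ≡ curveAt k →
      ∃[ y ] OnCurve curve ((w + ι q) ^ 2) y
    onCurve q k Y 2q≡k Y² = ⟦ + 0 ∷ Y ⟧ ρ , (begin
      ⟦ + 0 ∷ Y ⟧ ρ ^ 2               ≈⟨ *-congˡ (*-identityʳ _) ⟩
      ⟦ + 0 ∷ Y ⟧ ρ * ⟦ + 0 ∷ Y ⟧ ρ   ≈⟨ ⟦⟧-⊠ (+ 0 ∷ Y) (+ 0 ∷ Y) ρ ⟨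
      ⟦ square (+ 0 ∷ Y) ⟧ ρ          ≈⟨ ⟦⟧-cong ρ Y² ⟩
      ⟦ curveAt k ⟧ ρ                 ≈⟨ evaluate ⟩
      ⟦ A ⟧ ρ * v ^ 8 + ⟦ B ⟧ ρ * v ^ 4 + ⟦ C ⟧ ρ
        ≈⟨ +-congʳ (+-cong (*-congˡ (^-congˡ 8 v≈gu)) (*-congˡ (^-congˡ 4 v≈gu))) ⟩
      ⟦ A ⟧ ρ * (g * u) ^ 8 + ⟦ B ⟧ ρ * (g * u) ^ 4 + ⟦ C ⟧ ρ
        -- The right-hand side is the Horner form to which `eval curve (u ^ 2)` unfolds.
        ≈⟨ solve 5 (λ A B C g u → let x = u :^ 2; o = con (+ 0) in
             A :* (g :* u) :^ 8 :+ B :* (g :* u) :^ 4 :+ C :=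
             C :+ x :* (o :+ x :* (g :^ 4 :* B :+ x :* (o :+ x :* (g :^ 8 :* A :+ x :* o)))))
             ≈-refl (⟦ A ⟧ ρ) (⟦ B ⟧ ρ) (⟦ C ⟧ ρ) g u ⟩
      eval curve (u ^ 2)              ∎)
      where
      u = w + ι q
      v = ⟦ + 2 ∷ k ∷ [] ⟧ ρ
      v≈gu : v ≈ g * u
      v≈gu = begin
        φ (+ 2) + ρ * (φ k + ρ * 0#)
          ≈⟨ +-cong (≈-sym (*-identityʳ _)) (*-congˡ (+-congʳ (≈-trans (ι.⟦⟧-cong (sym 2q≡k)) (ι.*-homo _ q)))) ⟩
        φ (+ 2) * 1# + ρ * (φ (+ 2) * ι q + ρ * 0#)
          ≈⟨ +-congʳ (*-congˡ (≈-sym ρw≈1)) ⟩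
        φ (+ 2) * (ρ * w) + ρ * (φ (+ 2) * ι q + ρ * 0#)
          ≈⟨ solve 4 (λ f ρ w q → f :* (ρ :* w) :+ ρ :* (f :* q :+ ρ :* con (+ 0))
               := (f :* ρ) :* (w :+ q)) ≈-refl _ ρ w (ι q) ⟩
        g * u  ∎
      ⟦quartic⟧ : ⟦ quartic k ⟧ ρ ≈ (v * v) * (v * v)
      ⟦quartic⟧ = ≈-trans (⟦⟧-⊠ (square (+ 2 ∷ k ∷ [])) (square (+ 2 ∷ k ∷ [])) ρ)
        (*-cong (⟦⟧-⊠ (+ 2 ∷ k ∷ []) (+ 2 ∷ k ∷ []) ρ) (⟦⟧-⊠ (+ 2 ∷ k ∷ []) (+ 2 ∷ k ∷ []) ρ))
      evaluate : ⟦ curveAt k ⟧ ρ ≈ ⟦ A ⟧ ρ * v ^ 8 + ⟦ B ⟧ ρ * v ^ 4 + ⟦ C ⟧ ρ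
      evaluate = begin
        ⟦ curveAt k ⟧ ρ
          ≈⟨ ≈-trans (⟦⟧-⊞ (A ⊠ square (quartic k) ⊞ B ⊠ quartic k) C ρ)
               (+-congʳ (⟦⟧-⊞ (A ⊠ square (quartic k)) (B ⊠ quartic k) ρ)) ⟩
        ⟦ A ⊠ square (quartic k) ⟧ ρ + ⟦ B ⊠ quartic k ⟧ ρ + ⟦ C ⟧ ρ
          ≈⟨ +-congʳ (+-cong
               (≈-trans (⟦⟧-⊠ A (square (quartic k)) ρ)
                 (*-congˡ (≈-trans (⟦⟧-⊠ (quartic k) (quartic k) ρ) (*-cong ⟦quartic⟧ ⟦quartic⟧))))
               (≈-trans (⟦⟧-⊠ B (quartic k) ρ) (*-congˡ ⟦quartic⟧))) ⟩
        ⟦ A ⟧ ρ * ((v * v) * (v * v) * ((v * v) * (v * v))) + ⟦ B ⟧ ρ * ((v * v) * (v * v)) + ⟦ C ⟧ ρ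
          ≈⟨ solve 4 (λ A B C v →
               A :* ((v :* v) :* (v :* v) :* ((v :* v) :* (v :* v))) :+ B :* ((v :* v) :* (v :* v)) :+ C
                 := A :* v :^ 8 :+ B :* v :^ 4 :+ C) ≈-refl (⟦ A ⟧ ρ) (⟦ B ⟧ ρ) (⟦ C ⟧ ρ) v ⟩
        ⟦ A ⟧ ρ * v ^ 8 + ⟦ B ⟧ ρ * v ^ 4 + ⟦ C ⟧ ρ  ∎

    points : All (λ q → ∃[ y ] OnCurve curve ((w + ι q) ^ 2) y) offsets
    points =
        onCurve _ -[1+ 4 ] y₋₅ refl y₋₅²≡curveAt
      ∷ onCurve _ -[1+ 2 ] y₋₃ refl y₋₃²≡curveAt
      ∷ onCurve _ -[1+ 0 ] y₋₁ refl y₋₁²≡curveAt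
      ∷ onCurve _ (+ 1) y₁ refl y₁²≡curveAt
      ∷ onCurve _ (+ 3) y₃ refl y₃²≡curveAt
      ∷ onCurve _ (+ 5) y₅ refl y₅²≡curveAt
      ∷ []

    -- A(ρ) controls the degree; C(ρ) and D(ρ) control separability, since the discriminant in x² is
    -- g⁸ρ²D(ρ). The rational point is the one with offset -5/2.
    isEllipticCurve : ⟦ A ⟧ ρ # 0# → ⟦ C ⟧ ρ # 0# → ⟦ D ⟧ ρ # 0# → IsEllipticCurve curve
    isEllipticCurve A#0 C#0 D#0 =
        inj₂ (x#0y#0→xy#0 (^-# 8 g#0) A#0 , λ { _ (s≤s (s≤s (s≤s (s≤s (s≤s _))))) → ≈-refl })
      , separable C#0 (#-congʳ (≈-sym discriminant-curve)
          (x#0y#0→xy#0 (^-# 8 g#0) (x#0y#0→xy#0 ρ#0 (x#0y#0→xy#0 ρ#0 D#0))))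
      , inj₁ (_ , All.head points)

    I-curve : φ (+ 12) * (a * c) + b * b ≈ g ^ 8 * ⟦ I ⟧ ρ
    I-curve = begin
      φ (+ 12) * (a * c) + b * b
        ≈⟨ solve 6 (λ f g ρ A B C → f :* (g :^ 8 :* A :* C) :+ (g :^ 4 :* B) :* (g :^ 4 :* B)
             := g :^ 8 :* ((f :+ ρ :* con (+ 0)) :* (A :* C) :+ B :* B)) ≈-refl
             (φ (+ 12)) g ρ (⟦ A ⟧ ρ) (⟦ B ⟧ ρ) (⟦ C ⟧ ρ) ⟩
      g ^ 8 * (⟦ + 12 ∷ [] ⟧ ρ * (⟦ A ⟧ ρ * ⟦ C ⟧ ρ) + ⟦ B ⟧ ρ * ⟦ B ⟧ ρ)
        ≈⟨ *-congˡ (≈-trans (⟦⟧-⊞ ((+ 12 ∷ []) ⊠ (A ⊠ C)) (square B) ρ)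
             (+-cong (≈-trans (⟦⟧-⊠ (+ 12 ∷ []) (A ⊠ C) ρ) (*-congˡ (⟦⟧-⊠ A C ρ))) (⟦⟧-⊠ B B ρ))) ⟨
      g ^ 8 * ⟦ I ⟧ ρ  ∎

    -- The factor (g⁸)³ also occurs in (12ac + b²)³ and so cancels in j. The ρ² in each of the two
    -- discriminants leaves ρ⁴, the source of the distinct 11-adic valuations.
    ac-discriminant²-curve : a * c * (discriminant a b c * discriminant a b c)
      ≈ (g ^ 8) ^ 3 * (ρ ^ 4 * ⟦ jDenominator ⟧ ρ)
    ac-discriminant²-curve = begin
      a * c * (discriminant a b c * discriminant a b c)
        ≈⟨ *-congˡ (*-cong discriminant-curve discriminant-curve) ⟩
      a * c * (g ^ 8 * (ρ * (ρ * ⟦ D ⟧ ρ)) * (g ^ 8 * (ρ * (ρ * ⟦ D ⟧ ρ))))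
        ≈⟨ solve 5 (λ G ρ A C D →
             G :* A :* C :* (G :* (ρ :* (ρ :* D)) :* (G :* (ρ :* (ρ :* D))))
               := G :^ 3 :* (ρ :^ 4 :* (A :* C :* (D :* D)))) ≈-refl
             (g ^ 8) ρ (⟦ A ⟧ ρ) (⟦ C ⟧ ρ) (⟦ D ⟧ ρ) ⟩
      (g ^ 8) ^ 3 * (ρ ^ 4 * (⟦ A ⟧ ρ * ⟦ C ⟧ ρ * (⟦ D ⟧ ρ * ⟦ D ⟧ ρ)))
        ≈⟨ *-congˡ (*-congˡ (≈-trans (⟦⟧-⊠ (A ⊠ C) (square D) ρ)
             (*-cong (⟦⟧-⊠ A C ρ) (⟦⟧-⊠ D D ρ)))) ⟨
      (g ^ 8) ^ 3 * (ρ ^ 4 * ⟦ jDenominator ⟧ ρ)  ∎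

  j-invariance-curve : ∀ {ρ w ρ′ w′} (ρw≈1 : ρ * w ≈ 1#) (ρ′w′≈1 : ρ′ * w′ ≈ 1#) →
    Isomorphic (Curve.curve ρ w ρw≈1) (Curve.curve ρ′ w′ ρ′w′≈1) →
    ⟦ jNumerator ⟧ ρ′ * (ρ ^ 4 * ⟦ jDenominator ⟧ ρ) ≈
    ⟦ jNumerator ⟧ ρ * (ρ′ ^ 4 * ⟦ jDenominator ⟧ ρ′)
  j-invariance-curve {ρ} {w} {ρ′} {w′} ρw≈1 ρ′w′≈1 iso =
    #-cancelˡ (x#0y#0→xy#0 (G³#0 E.g#0) (G³#0 E′.g#0)) (begin
      G ^ 3 * G′ ^ 3 * (⟦ jNumerator ⟧ ρ′ * h)   ≈⟨ *-congˡ (*-congʳ (⟦jNumerator⟧ ρ′)) ⟩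
      G ^ 3 * G′ ^ 3 * (i′ * (i′ * i′) * h)
        ≈⟨ solve 4 (λ G G′ i h → G :^ 3 :* G′ :^ 3 :* (i :* (i :* i) :* h)
             := (G′ :* i) :^ 3 :* (G :^ 3 :* h)) ≈-refl G G′ i′ h ⟩
      (G′ * i′) ^ 3 * (G ^ 3 * h)
        ≈⟨ *-cong (^-congˡ 3 E′.I-curve) E.ac-discriminant²-curve ⟨
      (φ (+ 12) * (E′.a * E′.c) + E′.b * E′.b) ^ 3
        * (E.a * E.c * (discriminant E.a E.b E.c * discriminant E.a E.b E.c))
        ≈⟨ j-invariance {E.a} {E.b} {E.c} {E′.a} {E′.b} {E′.c} iso ⟩
      (φ (+ 12) * (E.a * E.c) + E.b * E.b) ^ 3
        * (E′.a * E′.c * (discriminant E′.a E′.b E′.c * discriminant E′.a E′.b E′.c))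
        ≈⟨ *-cong (^-congˡ 3 E.I-curve) E′.ac-discriminant²-curve ⟩
      (G * i) ^ 3 * (G′ ^ 3 * h′)
        ≈⟨ solve 4 (λ G G′ i h → G :^ 3 :* G′ :^ 3 :* (i :* (i :* i) :* h)
             := (G :* i) :^ 3 :* (G′ :^ 3 :* h)) ≈-refl G G′ i h′ ⟨
      G ^ 3 * G′ ^ 3 * (i * (i * i) * h′)        ≈⟨ *-congˡ (*-congʳ (⟦jNumerator⟧ ρ)) ⟨
      G ^ 3 * G′ ^ 3 * (⟦ jNumerator ⟧ ρ * h′)   ∎)
    where
    module E  = Curve ρ w ρw≈1
    module E′ = Curve ρ′ w′ ρ′w′≈1
    G  = E.g ^ 8
    G′ = E′.g ^ 8
    i  = ⟦ I ⟧ ρ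
    i′ = ⟦ I ⟧ ρ′
    h  = ρ ^ 4 * ⟦ jDenominator ⟧ ρ
    h′ = ρ′ ^ 4 * ⟦ jDenominator ⟧ ρ′
    G³#0 : ∀ {x} → x # 0# → (x ^ 8) ^ 3 # 0#
    G³#0 x#0 = ^-# 3 (^-# 8 x#0)
    ⟦jNumerator⟧ : ∀ x → ⟦ jNumerator ⟧ x ≈ ⟦ I ⟧ x * (⟦ I ⟧ x * ⟦ I ⟧ x)
    ⟦jNumerator⟧ x = ≈-trans (⟦⟧-⊠ I (square I) x) (*-congˡ (⟦⟧-⊠ I I x))

-- Reversed polynomials and the curve over ℚ(t).

11≢0 : ∀ {z} → ¬ + 11 ∣ z → z ≢ + 0
11≢0 11∤z refl = 11∤z (divides (+ 0) refl)

-- Reversal puts the `length p` entries of p in front of q. With `q = a ∷ []` and `n = 0` this reads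
-- off the leading coefficient of a reversed polynomial.
coeff-ʳ++ : ∀ p q n →
  Overℚ.coeff (map fromℤ (p ʳ++ q)) (length p ℕ.+ n) ≡ Overℚ.coeff (map fromℤ q) n
coeff-ʳ++ []      q n = refl
coeff-ʳ++ (a ∷ p) q n = trans
  (cong (Overℚ.coeff (map fromℤ (p ʳ++ (a ∷ q)))) (sym (ℕ.+-suc (length p) n)))
  (coeff-ʳ++ p (a ∷ q) (suc n))

module RationalFunctionField {k ℓ₁ ℓ₂} (K : HeytingField k ℓ₁ ℓ₂) (t : HeytingField.Carrier K)
  (ℚ⟨t⟩ : IsRationalFunctionField K t) where

  open OverField K
  open IsRationalFunctionField ℚ⟨t⟩ using (ι; transcendental)
  open Extension K ι (IsRationalFunctionField.isRingHomomorphism ℚ⟨t⟩)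
  open CommutativeRing ring using (setoid; *-congˡ; *-congʳ; +-cong; +-congˡ; +-congʳ; *-identityˡ)
    renaming (refl to ≈-refl; sym to ≈-sym; trans to ≈-trans)
  open HeytingField K using (heytingCommutativeRing; #⇒invertible)
  open HeytingProperties heytingCommutativeRing
  open SetoidReasoning setoid

  t#0 : t # 0#
  t#0 = #-congʳ
    (≈-trans (+-cong ι.0#-homo (*-congˡ (+-congʳ ι.1#-homo)))
      (solve 1 (λ t → con (+ 0) :+ t :* (con (+ 1) :+ t :* con (+ 0)) := t) ≈-refl t))
    -- The polynomial X, nonzero because its coefficient of index 1 is 1.
    (transcendental (0ℚ ∷ 1ℚ ∷ []) (λ x≈0 → contradiction (x≈0 1) λ ()))

  t⁻¹ : Carrier
  t⁻¹ = proj₁ (#⇒invertible t#0)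

  t⁻¹*t≈1 : t⁻¹ * t ≈ 1#
  t⁻¹*t≈1 = ≈-trans (*-congˡ (≈-sym (x-0≈x t))) (proj₁ (proj₂ (#⇒invertible t#0)))

  -- For q = 0 this is the reciprocal polynomial t^(n-1) p(t⁻¹), with n the length of p; writing t⁻¹
  -- separately avoids the subtraction in the exponent. The accumulator q carries the induction.
  ⟦⟧-ʳ++ : ∀ p q → ⟦ p ʳ++ q ⟧ t ≈ t ^ length p * (⟦ q ⟧ t + t⁻¹ * ⟦ p ⟧ t⁻¹)
  ⟦⟧-ʳ++ []      q = solve 2 (λ q r → q := con (+ 1) :* (q :+ r :* con (+ 0))) ≈-refl _ t⁻¹
  ⟦⟧-ʳ++ (a ∷ p) q = begin
    ⟦ p ʳ++ (a ∷ q) ⟧ t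
      ≈⟨ ⟦⟧-ʳ++ p (a ∷ q) ⟩
    t ^ n * (φ a + t * ⟦ q ⟧ t + t⁻¹ * ⟦ p ⟧ t⁻¹)
      ≈⟨ *-congˡ (≈-sym (*-identityˡ _)) ⟩
    t ^ n * (1# * (φ a + t * ⟦ q ⟧ t + t⁻¹ * ⟦ p ⟧ t⁻¹))
      ≈⟨ solve 6 (λ T a t q r p → T :* (con (+ 1) :* (a :+ t :* q :+ r :* p))
           := T :* (t :* q :+ con (+ 1) :* (a :+ r :* p))) ≈-refl (t ^ n) _ t _ t⁻¹ _ ⟩
    t ^ n * (t * ⟦ q ⟧ t + 1# * (φ a + t⁻¹ * ⟦ p ⟧ t⁻¹))
      ≈⟨ *-congˡ (+-congˡ (*-congʳ t⁻¹*t≈1)) ⟨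
    t ^ n * (t * ⟦ q ⟧ t + t⁻¹ * t * (φ a + t⁻¹ * ⟦ p ⟧ t⁻¹))
      ≈⟨ solve 5 (λ T t q r s → T :* (t :* q :+ r :* t :* s) := t :* T :* (q :+ r :* s))
           ≈-refl (t ^ n) t _ t⁻¹ _ ⟩
    t * t ^ n * (⟦ q ⟧ t + t⁻¹ * (φ a + t⁻¹ * ⟦ p ⟧ t⁻¹))  ∎
    where n = length p

  xy#0→y#0 : ∀ {x y} → x * y # 0# → y # 0#
  xy#0→y#0 {x} {y} xy#0 = let z , z*xy≈1 , _ = #⇒invertible xy#0 in
    invertibleˡ⇒# (z * x , ≈-trans
      (solve 3 (λ x y z → z :* x :* (y :- con (+ 0)) := z :* (x :* y :- con (+ 0))) ≈-refl x y z)
      z*xy≈1)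

  -- Up to a power of t, the value at t⁻¹ is the value at t of the reversed
  -- polynomial, whose leading coefficient is the constant term.
  ⟦⟧-# : ∀ p → constantTerm p ≢ + 0 → ⟦ p ⟧ t⁻¹ # 0#
  ⟦⟧-# []      0≢0 = contradiction refl 0≢0
  ⟦⟧-# (a ∷ p) a≢0 = xy#0→y#0 (#-congʳ
    (≈-trans (⟦⟧-ʳ++ (a ∷ p) [])
      (solve 3 (λ T r p → T :* (con (+ 0) :+ r :* p) := T :* r :* p)
         ≈-refl (t ^ suc (length p)) t⁻¹ (⟦ a ∷ p ⟧ t⁻¹)))
    (transcendental (map fromℤ ((a ∷ p) ʳ++ []))
      λ ≈[] → a≢0 (cong ↥_ (trans (sym (coeff-ʳ++ p (a ∷ []) 0)) (≈[] (length p ℕ.+ 0))))))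

  open Curve t⁻¹ t t⁻¹*t≈1

  ellipticCurve-with-points : ∃[ a ] ∃[ b ] ∃[ c ]
    (IsEllipticCurve (biquadratic a b c)
     × All (λ i → ∃[ y ] OnCurve (biquadratic a b c) ((t + ι i) ^ 2) y) offsets)
  ellipticCurve-with-points = a , b , c
    , isEllipticCurve (⟦⟧-# A (11≢0 11∤A)) (⟦⟧-# C (11≢0 11∤C)) (⟦⟧-# D (11≢0 11∤D))
    , points

-- Values of integer polynomials modulo 11.

infixl 8 _at_
_at_ : List ℤ → ℤ → ℤ
[]      at z = + 0
(a ∷ p) at z = a ℤ.+ z ℤ.* p at z

11∤-* : ∀ {i j} → ¬ + 11 ∣ i → ¬ + 11 ∣ j → ¬ + 11 ∣ i ℤ.* j
11∤-* {i} {j} 11∤i 11∤j 11∣ij =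
  [ 11∤i ∘ Signed.∣ᵤ⇒∣ , 11∤j ∘ Signed.∣ᵤ⇒∣ ]′
    (euclidsLemma ℤ.∣ i ∣ ℤ.∣ j ∣ (from-yes (prime? 11))
      (subst (11 ℕ∣.∣_) (ℤ.abs-* i j) (Signed.∣⇒∣ᵤ 11∣ij)))

-- A polynomial is congruent to its constant term at every multiple of 11.
11∤-at : ∀ p {z} → + 11 ∣ z → ¬ + 11 ∣ constantTerm p → ¬ + 11 ∣ p at z
11∤-at []      _    11∤0 = 11∤0
11∤-at (a ∷ p) 11∣z 11∤a 11∣p = 11∤a (Signed.∣m+n∣n⇒∣m 11∣p (Signed.∣m⇒∣m*n (p at _) 11∣z))

-- Specialisation to elliptic curves over ℚ.

module Specialisation where

  module ℚExtension = Extension ℚ.heytingField id (isRingHomomorphism Overℚ.rawRing refl)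
  open Overℚ using (_^_; biquadratic; Isomorphic; IsEllipticCurve; HasConsecutiveSquares)
  open ℚExtension using (⟦_⟧; module Curve)

  fromℤ-injective : ∀ {i j} → fromℤ i ≡ fromℤ j → i ≡ j
  fromℤ-injective = cong ↥_

  fromℤ-^ : ∀ z n → fromℤ (z ℤ.^ n) ≡ fromℤ z ^ n
  fromℤ-^ z zero    = refl
  fromℤ-^ z (suc n) = trans (fromℤ-* z (z ℤ.^ n)) (cong (fromℤ z ℚ.*_) (fromℤ-^ z n))

  fromℤ-at : ∀ p z → fromℤ (p at z) ≡ ⟦ p ⟧ (fromℤ z)
  fromℤ-at []      z = refl
  fromℤ-at (a ∷ p) z = trans (fromℤ-+ a (z ℤ.* p at z))
    (cong (fromℤ a ℚ.+_) (trans (fromℤ-* z (p at z)) (cong (fromℤ z ℚ.*_) (fromℤ-at p z))))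

  -- The value of ρ, so that t = 11^-(n+1). The exponent starts at 1 to make every value divisible
  -- by 11.
  param : ℕ → ℤ
  param n = (+ 11) ℤ.^ suc n

  11∣param : ∀ n → + 11 ∣ param n
  11∣param n = Signed.∣m⇒∣m*n ((+ 11) ℤ.^ n) Signed.∣-refl

  param-^≢0 : ∀ n k → param n ℤ.^ k ≢ + 0
  param-^≢0 n k eq with () ← ℤ.i^n≡0⇒i≡0 (+ 11) (suc n) (ℤ.i^n≡0⇒i≡0 (param n) k eq)

  module _ (n : ℕ) where

    private instance
      param-nonZero : ℚ.NonZero (fromℤ (param n))
      param-nonZero = ℚ.≢-nonZero {fromℤ (param n)}
        (param-^≢0 n 1 ∘ trans (ℤ.*-identityʳ (param n)) ∘ fromℤ-injective)

    w : ℚ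
    w = ℚ.1/ fromℤ (param n)

    param*w≡1 : fromℤ (param n) ℚ.* w ≡ 1ℚ
    param*w≡1 = ℚ.*-inverseʳ (fromℤ (param n))

  module E (n : ℕ) = Curve (fromℤ (param n)) (w n) (param*w≡1 n)

  isEllipticCurve-E : ∀ n → IsEllipticCurve (E.curve n)
  isEllipticCurve-E n = E.isEllipticCurve n
    (nonzero A 11∤A) (nonzero C 11∤C) (nonzero D 11∤D)
    where
    nonzero : ∀ p → ¬ + 11 ∣ constantTerm p → ⟦ p ⟧ (fromℤ (param n)) ≢ 0ℚ
    nonzero p 11∤p = 11≢0 (11∤-at p (11∣param n) 11∤p) ∘ fromℤ-injective ∘ trans (fromℤ-at p (param n))

  consecutiveSquares-E : ∀ n → HasConsecutiveSquares (E.curve n) 6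
  -- With u = t - 7/2, the terms u + 1, ..., u + 6 are t plus the entries of `offsets`, which are
  -- listed in increasing order.
  consecutiveSquares-E n = w n ℚ.- + 7 / 2 , λ i →
    subst (λ x → ∃[ y ] Overℚ.OnCurve (E.curve n) (x ^ 2) y)
      (trans (cong (w n ℚ.+_) (sym (shift i))) (sym (ℚ.+-assoc (w n) _ _)))
      (All.lookup (E.points n) (∈-lookup i))
    where
    shift : ∀ i → ℚ.- (+ 7 / 2) ℚ.+ suc (toℕ i) Overℚ.· 1ℚ ≡ lookup offsets i
    shift = from-yes (all? λ i →
      ℚ.- (+ 7 / 2) ℚ.+ suc (toℕ i) Overℚ.· 1ℚ ℚ.≟ lookup offsets i)

  -- 11-adic comparison of the j-invariants.

  fromℤ-cross : ∀ p q x y → fromℤ (p at x ℤ.* (y ℤ.^ 4 ℤ.* q at y)) ≡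
    ⟦ p ⟧ (fromℤ x) ℚ.* (fromℤ y ^ 4 ℚ.* ⟦ q ⟧ (fromℤ y))
  fromℤ-cross p q x y = trans (fromℤ-* (p at x) (y ℤ.^ 4 ℤ.* q at y)) (cong₂ ℚ._*_ (fromℤ-at p x)
    (trans (fromℤ-* (y ℤ.^ 4) (q at y)) (cong₂ ℚ._*_ (fromℤ-^ y 4) (fromℤ-at q y))))

  -- Equality of p/(ρ⁴q) at ρ = x and at ρ = y, with denominators cleared, as an equation in ℤ.
  CrossEquation : List ℤ → List ℤ → ℤ → ℤ → Set
  CrossEquation p q x y = p at y ℤ.* (x ℤ.^ 4 ℤ.* q at x) ≡ p at x ℤ.* (y ℤ.^ 4 ℤ.* q at y)

  crossEquation : ∀ p q x y →
    ⟦ p ⟧ (fromℤ y) ℚ.* (fromℤ x ^ 4 ℚ.* ⟦ q ⟧ (fromℤ x)) ≡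
    ⟦ p ⟧ (fromℤ x) ℚ.* (fromℤ y ^ 4 ℚ.* ⟦ q ⟧ (fromℤ y)) → CrossEquation p q x y
  crossEquation p q x y eq = fromℤ-injective
    (trans (fromℤ-cross p q y x) (trans eq (sym (fromℤ-cross p q x y))))

  j-invariance-E : ∀ m n → Isomorphic (E.curve m) (E.curve n) →
    ⟦ jNumerator ⟧ (fromℤ (param n)) ℚ.* (fromℤ (param m) ^ 4 ℚ.* ⟦ jDenominator ⟧ (fromℤ (param m))) ≡
    ⟦ jNumerator ⟧ (fromℤ (param m)) ℚ.* (fromℤ (param n) ^ 4 ℚ.* ⟦ jDenominator ⟧ (fromℤ (param n)))
  j-invariance-E m n = ℚExtension.j-invariance-curve {fromℤ (param m)} {w m} {fromℤ (param n)} {w n}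
      (param*w≡1 m) (param*w≡1 n)

  isomorphic⇒crossEquation : ∀ m n → Isomorphic (E.curve m) (E.curve n) →
    CrossEquation jNumerator jDenominator (param m) (param n)
  isomorphic⇒crossEquation m n iso = crossEquation jNumerator jDenominator (param m) (param n)
    (j-invariance-E m n iso)

  cancel-z⁴ : ∀ z d s t s′ t′ .{{_ : ℤ.NonZero (z ℤ.^ 4)}} →
    s′ ℤ.* (z ℤ.^ 4 ℤ.* t) ≡ s ℤ.* ((z ℤ.* d) ℤ.^ 4 ℤ.* t′) → s′ ℤ.* t ≡ d ℤ.^ 4 ℤ.* (s ℤ.* t′)
  cancel-z⁴ z d s t s′ t′ eq = ℤ.*-cancelˡ-≡ (z ℤ.^ 4) _ _ (begin
    z ℤ.^ 4 ℤ.* (s′ ℤ.* t)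
      ≡⟨ solve 3 (λ z s t → z :^ 4 :* (s :* t) := s :* (z :^ 4 :* t)) refl z s′ t ⟩
    s′ ℤ.* (z ℤ.^ 4 ℤ.* t)
      ≡⟨ eq ⟩
    s ℤ.* ((z ℤ.* d) ℤ.^ 4 ℤ.* t′)
      ≡⟨ solve 4 (λ z d s t → s :* ((z :* d) :^ 4 :* t) := z :^ 4 :* (d :^ 4 :* (s :* t)))
           refl z d s t′ ⟩
    z ℤ.^ 4 ℤ.* (d ℤ.^ 4 ℤ.* (s ℤ.* t′))  ∎)
    where
    open ≡-Reasoning
    open +-*-Solver

  -- The larger parameter is the smaller one times a positive power d of 11. Once the common fourth
  -- power is cancelled, d⁴ remains on the right alone, while by primality of 11 the left side
  -- p(11^(n+1)) q(11^(m+1)) is prime to 11.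
  ¬crossEquation : ∀ p q → ¬ + 11 ∣ constantTerm p → ¬ + 11 ∣ constantTerm q →
    ∀ m n → m ℕ.< n → ¬ CrossEquation p q (param m) (param n)
  ¬crossEquation p q 11∤p 11∤q m n m<n eq =
    11∤-* (11∤-at p (11∣param n) 11∤p) (11∤-at q (11∣param m) 11∤q)
      (subst (+ 11 ∣_) (sym (cancel-z⁴ (param m) (param o) (p at param m) (q at param m)
          (p at param n) (q at param n) eq′))
        (Signed.∣m⇒∣m*n (p at param m ℤ.* q at param n)
          (Signed.∣m⇒∣m*n (param o ℤ.^ 3) (11∣param o))))
    where
    -- Here n = m + 1 + o, so the quotient 11^(n-m) is exactly `param o`, again divisible by 11.
    o = proj₁ (ℕ.m≤n⇒∃[o]m+o≡n m<n)
    instance _ = ℤ.≢-nonZero (param-^≢0 m 4)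
    param-n : param n ≡ param m ℤ.* param o
    param-n = begin
      param n                         ≡⟨ cong param (proj₂ (ℕ.m≤n⇒∃[o]m+o≡n m<n)) ⟨
      (+ 11) ℤ.^ (suc (suc m ℕ.+ o))  ≡⟨ cong ((+ 11) ℤ.^_) (ℕ.+-suc (suc m) o) ⟨
      (+ 11) ℤ.^ (suc m ℕ.+ suc o)    ≡⟨ ℤ.^-distribˡ-+-* (+ 11) (suc m) (suc o) ⟩
      param m ℤ.* param o             ∎
      where open ≡-Reasoning
    eq′ : p at param n ℤ.* (param m ℤ.^ 4 ℤ.* q at param m) ≡
          p at param m ℤ.* ((param m ℤ.* param o) ℤ.^ 4 ℤ.* q at param n)
    eq′ = trans eq (cong (λ x → p at param m ℤ.* (x ℤ.^ 4 ℤ.* q at param n)) param-n)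

  crossEquation-≡ : ∀ p q → ¬ + 11 ∣ constantTerm p → ¬ + 11 ∣ constantTerm q →
    ∀ m n → CrossEquation p q (param m) (param n) → m ≡ n
  crossEquation-≡ p q 11∤p 11∤q m n eq with ℕ.<-cmp m n
  ... | tri< m<n _ _ = contradiction eq (¬crossEquation p q 11∤p 11∤q m n m<n)
  ... | tri≈ _ m≡n _ = m≡n
  ... | tri> _ _ n<m = contradiction (sym eq) (¬crossEquation p q 11∤p 11∤q n m n<m)

  nonisomorphic : ∀ m n → m ≢ n → ¬ Isomorphic (E.curve m) (E.curve n)
  nonisomorphic m n m≢n iso = m≢n
    (crossEquation-≡ jNumerator jDenominator 11∤jNumerator 11∤jDenominator m n
      (isomorphic⇒crossEquation m n iso))

theorem1 : ∀ {k ℓ₁ ℓ₂} →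
  ((K : HeytingField k ℓ₁ ℓ₂) (t : HeytingField.Carrier K)
   (ℚ⟨t⟩ : IsRationalFunctionField K t) →
   let open OverField K
       open IsRationalFunctionField ℚ⟨t⟩ using (ι)
   in ∃[ a ] ∃[ b ] ∃[ c ]
        (IsEllipticCurve (biquadratic a b c)
         × All (λ i → ∃[ y ] OnCurve (biquadratic a b c) ((t + ι i) ^ 2) y) offsets))
  ×
  (let open Overℚ
   in ∃ λ (a : ℕ → ℚ) → ∃ λ (b : ℕ → ℚ) → ∃ λ (c : ℕ → ℚ) →
        (∀ n → IsEllipticCurve (biquadratic (a n) (b n) (c n))
               × HasConsecutiveSquares (biquadratic (a n) (b n) (c n)) 6)
        × (∀ m n → m ≢ n →
             ¬ Isomorphic (biquadratic (a m) (b m) (c m)) (biquadratic (a n) (b n) (c n))))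
theorem1 = RationalFunctionField.ellipticCurve-with-points
         , E.a , E.b , E.c
         , (λ n → isEllipticCurve-E n , consecutiveSquares-E n) , nonisomorphic
  where open Specialisation
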